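{- The independence polynomial of any centipede is log-concave; that is, for every $n\geq 1$, the polynomial $I(W_n;x)$ is log-concave, where $W_n=P_n^{\ast}$.
   Context: All graphs are finite, undirected, without loops or multiple edges. $P_n$ denotes the (chordless) path on $n\geq 1$ vertices. For a graph $G$, $G^{\ast}$ denotes the graph obtained from $G$ by appending a single pendant edge to each vertex of $G$, i.e. by adding, for each vertex $v$ of $G$, one new vertex joined only to $v$. The centipede $W_n$ is the tree $W_n=P_n^{\ast}$, $n\geq 1$ (so it has $2n$ vertices). A stable set in a graph $G$ is a set of pairwise non-adjacent vertices; the stability number $\alpha(G)$ is the maximum size of a stable set in $G$. Let $s_k$ be the number of stable sets of cardinality $k$ in $G$ (so $s_0=1$); the independence polynomial of $G$ is $I(G;x)=\sum_{k=0}^{\alpha(G)}s_kx^k$. A finite sequence of real numbers $(a_0,a_1,\dots,a_n)$ is log-concave if $a_i^2\geq a_{i-1}a_{i+1}$ for all $1\leq i\leq n-1$; a polynomial is log-concave if its sequence of coefficients is log-concave. -}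

module Defs where

open import Data.Empty using (⊥)
open import Data.Fin.Base using (Fin; toℕ; splitAt)
open import Data.Fin.Properties using (all?) renaming (_≟_ to _≟ᶠ_)
open import Data.Fin.Subset using (Subset; inside; outside; _∈_; ∣_∣)
open import Data.Fin.Subset.Properties using (_∈?_)
open import Data.List.Base using (List; []; _∷_; _++_; map; filter; foldr; length)
open import Data.Nat.Base using (ℕ; zero; suc; _+_; _*_; _^_; _≤_; _⊔_)
open import Data.Nat.Properties using (_≟_; 1+n≢n)
open import Data.Sum.Base using (_⊎_; inj₁; inj₂; swap)
open import Data.Vec.Base using ([]; _∷_)
open import Data.Vec.Functional using (Vector)
open import Function.Base using (_on_)
open import Relation.Binary.Core using (Rel)
open import Relation.Binary.Definitions using (Symmetric; Irreflexive; Decidable)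
open import Relation.Binary.PropositionalEquality using (_≡_; refl; sym)
open import Relation.Nullary using (¬_; Dec; no; _⊎-dec_; _→-dec_; ¬?)
open import Level using (0ℓ)

private
  variable
    n : ℕ

record Graph (n : ℕ) : Set₁ where
  field
    Adj     : Rel (Fin n) 0ℓ
    symm    : Symmetric Adj
    irrefl  : Irreflexive _≡_ Adj
    adj?    : Decidable Adj

open Graph public

P : (n : ℕ) → Graph n
P n = record
  { Adj    = λ u v → toℕ v ≡ suc (toℕ u) ⊎ toℕ u ≡ suc (toℕ v)
  ; symm   = swap
  ; irrefl = λ { refl (inj₁ e) → 1+n≢n (sym e) ; refl (inj₂ e) → 1+n≢n (sym e) }
  ; adj?   = λ u v → (toℕ v ≟ suc (toℕ u)) ⊎-dec (toℕ u ≟ suc (toℕ v))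
  }

-- In the sum Fin n ⊎ Fin n, inj₁ v is the vertex v of G and inj₂ v is the
-- new vertex hung on v.  The relation is transported to Fin (n + n) by splitAt.
module _ (G : Graph n) where

  PendantAdj : Rel (Fin n ⊎ Fin n) 0ℓ
  PendantAdj (inj₁ u) (inj₁ v) = Adj G u v
  PendantAdj (inj₁ u) (inj₂ v) = u ≡ v
  PendantAdj (inj₂ u) (inj₁ v) = u ≡ v
  PendantAdj (inj₂ u) (inj₂ v) = ⊥

  pendantAdj-sym : Symmetric PendantAdj
  pendantAdj-sym {inj₁ u} {inj₁ v} a = symm G a
  pendantAdj-sym {inj₁ u} {inj₂ v} e = sym e
  pendantAdj-sym {inj₂ u} {inj₁ v} e = sym e

  pendantAdj-irrefl : Irreflexive _≡_ PendantAdj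
  pendantAdj-irrefl {inj₁ u} refl a = irrefl G refl a
  pendantAdj-irrefl {inj₂ u} refl ()

  pendantAdj? : Decidable PendantAdj
  pendantAdj? (inj₁ u) (inj₁ v) = adj? G u v
  pendantAdj? (inj₁ u) (inj₂ v) = u ≟ᶠ v
  pendantAdj? (inj₂ u) (inj₁ v) = u ≟ᶠ v
  pendantAdj? (inj₂ u) (inj₂ v) = no λ ()

infix 25 _✶

_✶ : Graph n → Graph (n + n)
_✶ {n} G = record
  { Adj    = PendantAdj G on splitAt n
  ; symm   = λ {u} {v} → pendantAdj-sym G {splitAt n u} {splitAt n v}
  ; irrefl = λ { {u} refl → pendantAdj-irrefl G {splitAt n u} refl }
  ; adj?   = λ u v → pendantAdj? G (splitAt n u) (splitAt n v)
  }

W : (n : ℕ) → Graph (n + n)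
W n = P n ✶

Stable : Graph n → Subset n → Set
Stable G S = ∀ u v → u ∈ S → v ∈ S → ¬ Adj G u v

stable? : (G : Graph n) (S : Subset n) → Dec (Stable G S)
stable? G S = all? λ u → all? λ v →
  (u ∈? S) →-dec ((v ∈? S) →-dec ¬? (adj? G u v))

-- Every subset occurs exactly once.
subsets : (n : ℕ) → List (Subset n)
subsets zero    = [] ∷ []
subsets (suc n) = map (outside ∷_) (subsets n) ++ map (inside ∷_) (subsets n)

stableSets : Graph n → List (Subset n)
stableSets {n} G = filter (stable? G) (subsets n)

-- The empty set is always stable, so the default value 0 is harmless.
α : Graph n → ℕ
α G = foldr _⊔_ 0 (map ∣_∣ (stableSets G))

s : Graph n → ℕ → ℕ
s G k = length (filter (λ S → ∣ S ∣ ≟ k) (stableSets G))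

-- A polynomial of formal degree d is given by its coefficients a₀, …, a_d.
Polynomial : ℕ → Set
Polynomial d = Vector ℕ (suc d)

I : (G : Graph n) → Polynomial (α G)
I G k = s G (toℕ k)

-- The indices h, i, j range over the consecutive triples i - 1, i, i + 1
-- lying in the index set of the sequence.
LogConcave : Vector ℕ n → Set
LogConcave {n} a = ∀ (h i j : Fin n) →
  toℕ i ≡ suc (toℕ h) → toℕ j ≡ suc (toℕ i) → a h * a j ≤ a i ^ 2

{-# OPTIONS --safe #-}
-- A stable set of G✶ is a stable set S of G together with a set of pendant
-- vertices avoiding S, so I(G✶; x) = Σⱼ sⱼ(G) xʲ (1 + x)ⁿ⁻ʲ.  Read from the top
-- degree down, its coefficients are those of Σⱼ sⱼ(G) zⁿ⁻ʲ at z = 1 + x.  The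
-- substitution z = 1 + x preserves log-concavity, by induction along Horner's
-- scheme, so it remains to see that I(Pₙ; x) is log-concave.  This follows from
-- I(Pₙ₊₂) = I(Pₙ₊₁) + x I(Pₙ), the induction carrying along that consecutive
-- polynomials interlace to second order.
module Submission where

open import Defs
open import Data.Bool.Base using (Bool; true; false; _∧_; if_then_else_)
open import Data.Bool.Properties using (∧-zeroʳ)
open import Data.Fin.Base using (zero; suc; toℕ; splitAt; join; _↑ˡ_; _↑ʳ_)
open import Data.Fin.Properties using (splitAt-join)
open import Data.Fin.Subset using (Subset; inside; outside; _∈_; _⊆_; ∁; ∣_∣)
open import Data.Fin.Subset.Properties
  using (_⊆?_; ∣p∣≤n; ∣∁p∣≡n∸∣p∣; p⊆q⇒∣p∣≤∣q∣; x∈∁p⇒x∉p; x∉p⇒x∈∁p)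
open import Data.List.Base as List using (List; filter; length)
open import Data.List.Properties using (map-++; map-∘)
open import Data.Nat.Base using (ℕ; zero; suc; _+_; _*_; _^_; _≤_; _<_; _≥_; z≤n; s≤s)
open import Data.Nat.Combinatorics using (_C_; nCk+nC[k+1]≡[n+1]C[k+1])
open import Data.Nat.ListAction using (sum)
open import Data.Nat.ListAction.Properties using (sum-++)
open import Data.Nat.Properties
open import Data.Nat.Tactic.RingSolver using (solve-∀)
open import Data.Product.Base using (_×_; _,_)
open import Data.Sum.Base as Sum using (inj₁; inj₂; [_,_]′)
open import Data.Vec.Base using ([]; _∷_; _++_; here; there)
open import Function.Base using (_∘_)
open import Function.Bundles using (_⇔_; mk⇔)
open import Relation.Binary.PropositionalEquality
open import Relation.Nullary using (¬_; yes; no; does; _×-dec_)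
open import Relation.Nullary.Decidable using (does-⇔; dec-false)
open import Relation.Unary using (Pred; Decidable)

-- Log-concavity and the comparison of ratios without division.

LogConcaveSeq : (ℕ → ℕ) → Set
LogConcaveSeq f = ∀ k → f k * f (2 + k) ≤ f (1 + k) * f (1 + k)

-- Excludes internal zeros: 1, 0, 0, 1, 0, 0, ... satisfies `LogConcaveSeq`, but ratio comparisons
-- cannot be chained across its gap.
VanishesOnward : (ℕ → ℕ) → Set
VanishesOnward f = ∀ k → f k ≡ 0 → f (1 + k) ≡ 0

-- Transitivity of a/b ≤ c/d ≤ e/f in cross-multiplied form.
ratio-trans : ∀ a b c d e f → a * d ≤ c * b → c * f ≤ e * d →
              (d ≡ 0 → f ≡ 0) → a * f ≤ e * b
-- With `d = 0` there is nothing to cancel; then `f = 0` as well, and the left side vanishes.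
ratio-trans a b c zero e f _ _ f≡0 rewrite f≡0 refl | *-zeroʳ a = z≤n
ratio-trans a b c d@(suc _) e f ad≤cb cf≤ed _ = *-cancelʳ-≤ (a * f) (e * b) d (begin
  (a * f) * d  ≡⟨ swapʳ a f d ⟩
  (a * d) * f  ≤⟨ *-monoˡ-≤ f ad≤cb ⟩
  (c * b) * f  ≡⟨ swapʳ c b f ⟩
  (c * f) * b  ≤⟨ *-monoˡ-≤ b cf≤ed ⟩
  (e * d) * b  ≡⟨ swapʳ e d b ⟩
  (e * b) * d  ∎)
  where
  open ≤-Reasoning
  swapʳ : ∀ x y z → (x * y) * z ≡ (x * z) * y
  swapʳ = solve-∀

*-+-≤ : ∀ p {r s a b} → p * r ≤ a → p * s ≤ b → p * (r + s) ≤ a + b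
*-+-≤ p {r} {s} pr≤a ps≤b = ≤-trans (≤-reflexive (*-distribˡ-+ p r s)) (+-mono-≤ pr≤a ps≤b)

+-*-≤ : ∀ r {p q a b} → p * r ≤ a → q * r ≤ b → (p + q) * r ≤ a + b
+-*-≤ r {p} {q} pr≤a qr≤b = ≤-trans (≤-reflexive (*-distribʳ-+ r p q)) (+-mono-≤ pr≤a qr≤b)

square-+ : ∀ a b → (a * a + b * a) + (b * a + b * b) ≡ (a + b) * (a + b)
square-+ = solve-∀

-- Horner's scheme at 1 + x

-- horner f m k is the coefficient of xᵏ in Σ_{j ≤ m} f j (1 + x)ᵐ⁻ʲ.
horner : (ℕ → ℕ) → ℕ → ℕ → ℕ
horner f zero    zero    = f 0
horner f zero    (suc k) = 0
horner f (suc m) zero    = horner f m zero + f (suc m)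
horner f (suc m) (suc k) = horner f m (suc k) + horner f m k

module _ (f : ℕ → ℕ) (lc : LogConcaveSeq f) (van : VanishesOnward f) where

  private
    H : ℕ → ℕ → ℕ
    H = horner f

  horner-vanishes : ∀ m → VanishesOnward (H m)
  horner-vanishes zero    k       _ = refl
  horner-vanishes (suc m) zero    e
    rewrite m+n≡0⇒m≡0 (H m 0) e | horner-vanishes m 0 (m+n≡0⇒m≡0 (H m 0) e) = refl
  horner-vanishes (suc m) (suc k) e
    rewrite m+n≡0⇒m≡0 (H m (suc k)) e
          | horner-vanishes m (suc k) (m+n≡0⇒m≡0 (H m (suc k)) e) = refl

  -- Since `H m 0` is the sum of `f` up to `m`, this is equivalent to log-concavity of the partial
  -- sums. It is also `horner-ratio` at index -1, if `f (1 + m)` is read as the coefficient of `H m`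
  -- just below the constant one.
  horner-constant-ratio : ∀ m → H m 0 * f (2 + m) ≤ f (1 + m) * H (1 + m) 0
  horner-constant-ratio zero    = begin
    f 0 * f 2              ≤⟨ lc 0 ⟩
    f 1 * f 1              ≤⟨ *-monoʳ-≤ (f 1) (m≤n+m (f 1) (f 0)) ⟩
    f 1 * (f 0 + f 1)      ∎
    where open ≤-Reasoning
  horner-constant-ratio (suc m) = begin
    (H m 0 + r₁) * r₃          ≤⟨ +-*-≤ r₃ {H m 0} {r₁} bound (lc (1 + m)) ⟩
    r₂ * H (1 + m) 0 + r₂ * r₂ ≡⟨ *-distribˡ-+ r₂ (H (1 + m) 0) r₂ ⟨
    r₂ * (H (1 + m) 0 + r₂)    ∎
    where
    open ≤-Reasoning
    r₁ = f (1 + m)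
    r₂ = f (2 + m)
    r₃ = f (3 + m)
    bound : H m 0 * r₃ ≤ r₂ * H (1 + m) 0
    bound = ratio-trans (H m 0) (H (1 + m) 0) r₁ r₂ r₂ r₃
              (horner-constant-ratio m) (lc (1 + m)) (van (2 + m))

  -- Log-concavity of `H m` at its lower end, once `f (1 + m)` is placed below the constant
  -- coefficient. It supplies the case `k = 0` of `horner-ratio`.
  horner-linear-ratio : ∀ m → f (1 + m) * H m 1 ≤ H m 0 * H m 0
  horner-linear-ratio zero    rewrite *-zeroʳ (f 1) = z≤n
  horner-linear-ratio (suc m) = begin
    r₂ * (q₁ + q₀)       ≤⟨ *-+-≤ r₂ {q₁} {q₀} bound r₂q₀≤r₁p ⟩
    q₀ * p + r₁ * p      ≡⟨ *-distribʳ-+ p q₀ r₁ ⟨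
    p * p                ∎
    where
    open ≤-Reasoning
    r₁ = f (1 + m)
    r₂ = f (2 + m)
    q₀ = H m 0
    q₁ = H m 1
    p  = H (1 + m) 0
    r₂q₀≤r₁p : r₂ * q₀ ≤ r₁ * p
    r₂q₀≤r₁p = ≤-trans (≤-reflexive (*-comm r₂ q₀)) (horner-constant-ratio m)
    -- The chain r₂/p ≤ r₁/q₀ ≤ q₀/q₁.
    bound : r₂ * q₁ ≤ q₀ * p
    bound = ratio-trans r₂ p r₁ q₀ q₀ q₁ r₂q₀≤r₁p (horner-linear-ratio m) (horner-vanishes m 0)

  -- Mutual induction on `m`. The ratio of `H (1 + m) k` to `H m k` is non-decreasing in `k` because
  -- `H m` is log-concave; the chain p/p₁ ≤ q₀/q₁ ≤ q₁/q₂ then makes `H (1 + m)` log-concave.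
  horner-logConcave : ∀ m → LogConcaveSeq (H m)
  horner-ratio : ∀ m k → H (1 + m) k * H m (1 + k) ≤ H m k * H (1 + m) (1 + k)

  horner-ratio m zero    = begin
    (q₀ + r) * q₁           ≤⟨ +-*-≤ q₁ {q₀} {r} ≤-refl (horner-linear-ratio m) ⟩
    q₀ * q₁ + q₀ * q₀       ≡⟨ *-distribˡ-+ q₀ q₁ q₀ ⟨
    q₀ * (q₁ + q₀)          ∎
    where
    open ≤-Reasoning
    r  = f (1 + m)
    q₀ = H m 0
    q₁ = H m 1
  horner-ratio m (suc k) = begin
    (q₁ + q₀) * q₂          ≤⟨ +-*-≤ q₂ {q₁} {q₀} ≤-refl (horner-logConcave m k) ⟩
    q₁ * q₂ + q₁ * q₁       ≡⟨ *-distribˡ-+ q₁ q₂ q₁ ⟨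
    q₁ * (q₂ + q₁)          ∎
    where
    open ≤-Reasoning
    q₀ = H m k
    q₁ = H m (1 + k)
    q₂ = H m (2 + k)

  horner-logConcave zero    zero    rewrite *-zeroʳ (f 0) = z≤n
  horner-logConcave zero    (suc k) = z≤n
  horner-logConcave (suc m) k       = begin
    p * (q₂ + q₁)           ≤⟨ *-+-≤ p {q₂} {q₁} bound (horner-ratio m k) ⟩
    q₁ * p₁ + q₀ * p₁       ≡⟨ *-distribʳ-+ p₁ q₁ q₀ ⟨
    p₁ * p₁                 ∎
    where
    open ≤-Reasoning
    p  = H (1 + m) k
    p₁ = H (1 + m) (1 + k)
    q₀ = H m k
    q₁ = H m (1 + k)
    q₂ = H m (2 + k)
    bound : p * q₂ ≤ q₁ * p₁
    bound = ratio-trans p p₁ q₀ q₁ q₁ q₂ (horner-ratio m k) (horner-logConcave m k)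
              (horner-vanishes m (suc k))

-- Linearity of Horner's scheme and its value on indicators.

horner-cong : ∀ {f g} → (∀ j → f j ≡ g j) → ∀ m i → horner f m i ≡ horner g m i
horner-cong f≗g zero    zero    = f≗g 0
horner-cong f≗g zero    (suc i) = refl
horner-cong f≗g (suc m) zero    = cong₂ _+_ (horner-cong f≗g m 0) (f≗g (suc m))
horner-cong f≗g (suc m) (suc i) = cong₂ _+_ (horner-cong f≗g m (suc i)) (horner-cong f≗g m i)

horner-zero : ∀ m i → horner (λ _ → 0) m i ≡ 0
horner-zero zero    zero    = refl
horner-zero zero    (suc i) = refl
horner-zero (suc m) zero    = cong (_+ 0) (horner-zero m 0)
horner-zero (suc m) (suc i) = cong₂ _+_ (horner-zero m (suc i)) (horner-zero m i)

+-interchange : ∀ a b c d → (a + b) + (c + d) ≡ (a + c) + (b + d)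
+-interchange = solve-∀

horner-+ : ∀ f g m i → horner (λ j → f j + g j) m i ≡ horner f m i + horner g m i
horner-+ f g zero    zero    = refl
horner-+ f g zero    (suc i) = refl
horner-+ f g (suc m) zero    =
  trans (cong (_+ (f (suc m) + g (suc m))) (horner-+ f g m 0))
        (+-interchange (horner f m 0) _ _ _)
horner-+ f g (suc m) (suc i) =
  trans (cong₂ _+_ (horner-+ f g m (suc i)) (horner-+ f g m i))
        (+-interchange (horner f m (suc i)) _ _ _)

horner-shift : ∀ f → f 0 ≡ 0 → ∀ m i → horner f (suc m) i ≡ horner (f ∘ suc) m i
horner-shift f f0≡0 zero    zero          = cong (_+ f 1) f0≡0
horner-shift f f0≡0 zero    (suc zero)    = f0≡0
horner-shift f f0≡0 zero    (suc (suc i)) = refl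
horner-shift f f0≡0 (suc m) zero          = cong (_+ f (2 + m)) (horner-shift f f0≡0 m 0)
horner-shift f f0≡0 (suc m) (suc i)       =
  cong₂ _+_ (horner-shift f f0≡0 m (suc i)) (horner-shift f f0≡0 m i)

⟦_⟧ : Bool → ℕ
⟦ b ⟧ = if b then 1 else 0

-- Only the term `j = a` survives. It is the `d`-th power of `1 + x`, for which Horner's step is
-- Pascal's rule.
horner-indicator : ∀ a d i → horner (λ j → ⟦ does (a ≟ j) ⟧) (a + d) i ≡ d C i
horner-indicator (suc a) d       i       =
  trans (horner-shift _ refl (a + d) i) (horner-indicator a d i)
horner-indicator zero    zero    zero    = refl
horner-indicator zero    zero    (suc i) = refl
horner-indicator zero    (suc d) zero    =
  trans (+-identityʳ _) (horner-indicator zero d 0)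
horner-indicator zero    (suc d) (suc i) = trans
  (cong₂ _+_ (horner-indicator zero d (suc i)) (horner-indicator zero d i))
  (trans (+-comm (d C suc i) (d C i)) (nCk+nC[k+1]≡[n+1]C[k+1] d i))

-- Sums over all subsets

-- Recursion on the first entry, instead of a sum over the list `subsets n`, lets a case distinction
-- on a vertex hold by definition.
∑ : ∀ {n} → (Subset n → ℕ) → ℕ
∑ {zero}  w = w []
∑ {suc n} w = ∑ (w ∘ (outside ∷_)) + ∑ (w ∘ (inside ∷_))

∑-cong : ∀ {n} {v w : Subset n → ℕ} → (∀ S → v S ≡ w S) → ∑ v ≡ ∑ w
∑-cong {zero}  v≗w = v≗w []
∑-cong {suc n} v≗w = cong₂ _+_ (∑-cong (v≗w ∘ (outside ∷_))) (∑-cong (v≗w ∘ (inside ∷_)))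

∑-zero : ∀ {n} {w : Subset n → ℕ} → (∀ S → w S ≡ 0) → ∑ w ≡ 0
∑-zero {zero}  w≗0 = w≗0 []
∑-zero {suc n} w≗0 = cong₂ _+_ (∑-zero (w≗0 ∘ (outside ∷_))) (∑-zero (w≗0 ∘ (inside ∷_)))

∑-++ : ∀ m n (w : Subset (m + n) → ℕ) → ∑ w ≡ ∑ (λ (S : Subset m) → ∑ (λ (L : Subset n) → w (S ++ L)))
∑-++ zero    n w = refl
∑-++ (suc m) n w = cong₂ _+_ (∑-++ m n (w ∘ (outside ∷_))) (∑-++ m n (w ∘ (inside ∷_)))

horner-∑ : ∀ {n} (w : Subset n → ℕ → ℕ) m i →
           horner (λ j → ∑ (λ S → w S j)) m i ≡ ∑ (λ S → horner (w S) m i)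
horner-∑ {zero}  w m i = refl
horner-∑ {suc n} w m i = trans (horner-+ _ _ m i)
  (cong₂ _+_ (horner-∑ (w ∘ (outside ∷_)) m i) (horner-∑ (w ∘ (inside ∷_)) m i))

sum-subsets : ∀ n (w : Subset n → ℕ) → sum (List.map w (subsets n)) ≡ ∑ w
sum-subsets zero    w = +-identityʳ (w [])
sum-subsets (suc n) w = begin
  sum (List.map w (outs List.++ ins))
    ≡⟨ cong sum (map-++ w outs ins) ⟩
  sum (List.map w outs List.++ List.map w ins)
    ≡⟨ sum-++ (List.map w outs) (List.map w ins) ⟩
  sum (List.map w outs) + sum (List.map w ins)
    ≡⟨ cong₂ _+_ (half outside) (half inside) ⟩
  ∑ w ∎
  where
  open ≡-Reasoning
  outs = List.map (outside ∷_) (subsets n)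
  ins  = List.map (inside ∷_) (subsets n)
  half : ∀ b → sum (List.map w (List.map (b ∷_) (subsets n))) ≡ ∑ (w ∘ (b ∷_))
  half b = trans (cong sum (sym (map-∘ (subsets n)))) (sum-subsets n (w ∘ (b ∷_)))

-- Counting subsets by size.

length-filter-filter :
  ∀ {a p q} {A : Set a} {P : Pred A p} {Q : Pred A q}
  (P? : Decidable P) (Q? : Decidable Q) (xs : List A) →
  length (filter Q? (filter P? xs)) ≡ sum (List.map (λ x → ⟦ does (P? x) ∧ does (Q? x) ⟧) xs)
length-filter-filter P? Q? List.[]       = refl
length-filter-filter P? Q? (x List.∷ xs) with does (P? x)
... | false = length-filter-filter P? Q? xs
... | true  with does (Q? x)
...   | false = length-filter-filter P? Q? xs
...   | true  = cong suc (length-filter-filter P? Q? xs)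

s-∑ : ∀ {n} (G : Graph n) k → s G k ≡ ∑ (λ S → ⟦ does (stable? G S) ∧ does (∣ S ∣ ≟ k) ⟧)
s-∑ {n} G k = trans
  (length-filter-filter (stable? G) (λ S → ∣ S ∣ ≟ k) (subsets n))
  (sum-subsets n _)

∣++∣ : ∀ {m n} (S : Subset m) (L : Subset n) → ∣ S ++ L ∣ ≡ ∣ S ∣ + ∣ L ∣
∣++∣ []            L = refl
∣++∣ (outside ∷ S) L = ∣++∣ S L
∣++∣ (inside  ∷ S) L = cong suc (∣++∣ S L)

∣S∣+∣∁S∣≡n : ∀ {n} (S : Subset n) → ∣ S ∣ + ∣ ∁ S ∣ ≡ n
∣S∣+∣∁S∣≡n S = trans (cong (∣ S ∣ +_) (∣∁p∣≡n∸∣p∣ S)) (m+[n∸m]≡n (∣p∣≤n S))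

-- Here `i` counts the elements of `Q` left out of `L`, and the sum counts the ways to choose them.
-- Pascal's rule splits on whether the first element of `Q` is left out.
count-⊆ : ∀ {n} (Q : Subset n) i →
          ∑ (λ L → ⟦ does (L ⊆? Q) ∧ does (∣ L ∣ + i ≟ ∣ Q ∣) ⟧) ≡ ∣ Q ∣ C i
count-⊆ []            zero    = refl
count-⊆ []            (suc i) = refl
count-⊆ {suc n} (outside ∷ Q) i =
  trans (cong₂ _+_ (count-⊆ Q i) (∑-zero {n} (λ _ → refl))) (+-identityʳ _)
count-⊆ (inside ∷ Q)  zero    =
  cong₂ _+_ (∑-zero too-small) (count-⊆ Q 0)
  where
  too-small : ∀ L → ⟦ does (L ⊆? Q) ∧ does (∣ L ∣ + 0 ≟ suc ∣ Q ∣) ⟧ ≡ 0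
  too-small L with L ⊆? Q
  ... | no  _   = refl
  ... | yes L⊆Q = cong ⟦_⟧ (dec-false (∣ L ∣ + 0 ≟ suc ∣ Q ∣)
    (<⇒≢ (s≤s (≤-trans (≤-reflexive (+-identityʳ ∣ L ∣)) (p⊆q⇒∣p∣≤∣q∣ L⊆Q)))))
count-⊆ (inside ∷ Q)  (suc i) = trans
  (cong₂ _+_
    (trans (∑-cong (λ L → cong (λ l → ⟦ does (L ⊆? Q) ∧ does (l ≟ suc ∣ Q ∣) ⟧) (+-suc ∣ L ∣ i)))
           (count-⊆ Q i))
    (count-⊆ Q (suc i)))
  (nCk+nC[k+1]≡[n+1]C[k+1] ∣ Q ∣ i)

-- Stable sets of G ✶

-- Phrased through `splitAt`, by which adjacency in `G ✶` is defined, so that one case split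
-- resolves both membership and adjacency.
∈-++⁻ : ∀ {m n} (S : Subset m) (L : Subset n) {u} → u ∈ S ++ L →
        [ _∈ S , _∈ L ]′ (splitAt m u)
∈-++⁻ []      L u∈L  = u∈L
∈-++⁻ (b ∷ S) L here = here
∈-++⁻ {suc m} (b ∷ S) L {suc u} (there u∈) with splitAt m u | ∈-++⁻ S L u∈
... | inj₁ _ | v∈S = there v∈S
... | inj₂ _ | v∈L = v∈L

∈-++⁺ˡ : ∀ {m n} (S : Subset m) (L : Subset n) {u} → u ∈ S → u ↑ˡ n ∈ S ++ L
∈-++⁺ˡ (b ∷ S) L here       = here
∈-++⁺ˡ (b ∷ S) L (there u∈) = there (∈-++⁺ˡ S L u∈)

∈-++⁺ʳ : ∀ {m n} (S : Subset m) (L : Subset n) {u} → u ∈ L → m ↑ʳ u ∈ S ++ L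
∈-++⁺ʳ []      L u∈ = u∈
∈-++⁺ʳ (b ∷ S) L u∈ = there (∈-++⁺ʳ S L u∈)

module _ {n : ℕ} (G : Graph n) where

  adj-join : ∀ x y → PendantAdj G x y → Adj (G ✶) (join n n x) (join n n y)
  adj-join x y = subst₂ (PendantAdj G) (sym (splitAt-join n n x)) (sym (splitAt-join n n y))

  -- Pendant vertices are pairwise non-adjacent, so the only constraint on `L` is that no vertex is
  -- chosen together with its own pendant.
  stable-✶ : ∀ S L → Stable (G ✶) (S ++ L) ⇔ (Stable G S × L ⊆ ∁ S)
  stable-✶ S L = mk⇔ to from
    where
    to : Stable (G ✶) (S ++ L) → Stable G S × L ⊆ ∁ S
    to st =
      (λ u v u∈S v∈S uv → st _ _ (∈-++⁺ˡ S L u∈S) (∈-++⁺ˡ S L v∈S) (adj-join (inj₁ u) (inj₁ v) uv)) ,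
      (λ {v} v∈L → x∉p⇒x∈∁p λ v∈S →
        st _ _ (∈-++⁺ˡ S L v∈S) (∈-++⁺ʳ S L v∈L) (adj-join (inj₁ v) (inj₂ v) refl))
    from : Stable G S × L ⊆ ∁ S → Stable (G ✶) (S ++ L)
    from (st , L⊆∁S) u v u∈ v∈ uv with splitAt n u | ∈-++⁻ S L u∈ | splitAt n v | ∈-++⁻ S L v∈
    ... | inj₁ a | a∈S | inj₁ b | b∈S = st a b a∈S b∈S uv
    ... | inj₁ a | a∈S | inj₂ b | b∈L = x∈∁p⇒x∉p (L⊆∁S b∈L) (subst (_∈ S) uv a∈S)
    ... | inj₂ a | a∈L | inj₁ b | b∈S = x∈∁p⇒x∉p (L⊆∁S a∈L) (subst (_∈ S) (sym uv) b∈S)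

  s-✶-∑ : ∀ k → s (G ✶) k ≡
    ∑ (λ S → ∑ (λ L → ⟦ (does (stable? G S) ∧ does (L ⊆? ∁ S)) ∧ does (∣ S ∣ + ∣ L ∣ ≟ k) ⟧))
  s-✶-∑ k = trans (s-∑ (G ✶) k) (trans (∑-++ n n _) (∑-cong λ S → ∑-cong λ L →
    cong ⟦_⟧ (cong₂ _∧_
      (does-⇔ (stable-✶ S L) (stable? (G ✶) (S ++ L)) (stable? G S ×-dec (L ⊆? ∁ S)))
      (cong (λ l → does (l ≟ k)) (∣++∣ S L)))))

  s-✶-vanishes : ∀ {k} → n < k → s (G ✶) k ≡ 0
  s-✶-vanishes {k} n<k = trans (s-✶-∑ k) (∑-zero λ S → ∑-zero λ L → term S L)
    where
    term : ∀ S L → ⟦ (does (stable? G S) ∧ does (L ⊆? ∁ S)) ∧ does (∣ S ∣ + ∣ L ∣ ≟ k) ⟧ ≡ 0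
    term S L with L ⊆? ∁ S
    ... | no _ rewrite ∧-zeroʳ (does (stable? G S)) = refl
    ... | yes L⊆∁S
      rewrite dec-false (∣ S ∣ + ∣ L ∣ ≟ k) (<⇒≢ (≤-<-trans
                (≤-trans (+-monoʳ-≤ ∣ S ∣ (p⊆q⇒∣p∣≤∣q∣ L⊆∁S)) (≤-reflexive (∣S∣+∣∁S∣≡n S))) n<k))
            | ∧-zeroʳ (does (stable? G S) ∧ true) = refl

  -- A stable `S` with `j` vertices extends by `k - j` of its `n - j` free pendants, that is, by
  -- omitting `i` of them. The number of ways is the coefficient of xⁱ in the power `n - j` of
  -- `1 + x`.
  s-✶ : ∀ k i → k + i ≡ n → s (G ✶) k ≡ horner (s G) n i
  s-✶ k i k+i≡n = begin
    s (G ✶) k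
      ≡⟨ s-✶-∑ k ⟩
    ∑ (λ S → ∑ (λ L → ⟦ (does (stable? G S) ∧ does (L ⊆? ∁ S)) ∧ does (∣ S ∣ + ∣ L ∣ ≟ k) ⟧))
      ≡⟨ ∑-cong pendants ⟩
    ∑ (λ S → horner (λ j → ⟦ does (stable? G S) ∧ does (∣ S ∣ ≟ j) ⟧) n i)
      ≡⟨ horner-∑ (λ S j → ⟦ does (stable? G S) ∧ does (∣ S ∣ ≟ j) ⟧) n i ⟨
    horner (λ j → ∑ (λ S → ⟦ does (stable? G S) ∧ does (∣ S ∣ ≟ j) ⟧)) n i
      ≡⟨ horner-cong (s-∑ G) n i ⟨
    horner (s G) n i ∎
    where
    open ≡-Reasoning

    size-⇔ : ∀ (S L : Subset n) → (∣ S ∣ + ∣ L ∣ ≡ k) ⇔ (∣ L ∣ + i ≡ ∣ ∁ S ∣)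
    size-⇔ S L = mk⇔
      (λ e → +-cancelˡ-≡ ∣ S ∣ _ _ (trans (sym (+-assoc ∣ S ∣ ∣ L ∣ i)) (trans (cong (_+ i) e) total)))
      (λ e → +-cancelʳ-≡ i _ _ (trans (+-assoc ∣ S ∣ ∣ L ∣ i) (trans (cong (∣ S ∣ +_) e) (sym total))))
      where
      total : k + i ≡ ∣ S ∣ + ∣ ∁ S ∣
      total = trans k+i≡n (sym (∣S∣+∣∁S∣≡n S))

    pendants : ∀ S →
      ∑ (λ L → ⟦ (does (stable? G S) ∧ does (L ⊆? ∁ S)) ∧ does (∣ S ∣ + ∣ L ∣ ≟ k) ⟧) ≡
      horner (λ j → ⟦ does (stable? G S) ∧ does (∣ S ∣ ≟ j) ⟧) n i
    pendants S with does (stable? G S)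
    ... | false = trans (∑-zero {n} (λ _ → refl)) (sym (horner-zero n i))
    ... | true  = begin
      ∑ (λ L → ⟦ does (L ⊆? ∁ S) ∧ does (∣ S ∣ + ∣ L ∣ ≟ k) ⟧)
        ≡⟨ ∑-cong (λ L → cong (λ b → ⟦ does (L ⊆? ∁ S) ∧ b ⟧)
             (does-⇔ (size-⇔ S L) (∣ S ∣ + ∣ L ∣ ≟ k) (∣ L ∣ + i ≟ ∣ ∁ S ∣))) ⟩
      ∑ (λ L → ⟦ does (L ⊆? ∁ S) ∧ does (∣ L ∣ + i ≟ ∣ ∁ S ∣) ⟧)
        ≡⟨ count-⊆ (∁ S) i ⟩
      ∣ ∁ S ∣ C i
        ≡⟨ horner-indicator ∣ S ∣ ∣ ∁ S ∣ i ⟨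
      horner (λ j → ⟦ does (∣ S ∣ ≟ j) ⟧) (∣ S ∣ + ∣ ∁ S ∣) i
        ≡⟨ cong (λ m → horner (λ j → ⟦ does (∣ S ∣ ≟ j) ⟧) m i) (∣S∣+∣∁S∣≡n S) ⟩
      horner (λ j → ⟦ does (∣ S ∣ ≟ j) ⟧) n i ∎

  ✶-logConcave : LogConcaveSeq (s G) → VanishesOnward (s G) → LogConcaveSeq (s (G ✶))
  ✶-logConcave lc van k with ≤-<-connex (2 + k) n
  ... | inj₂ n<2+k rewrite s-✶-vanishes n<2+k | *-zeroʳ (s (G ✶) k) = z≤n
  ... | inj₁ 2+k≤n with m≤n⇒∃[o]m+o≡n 2+k≤n
  -- Coefficients are read in reverse: the indices `k`, `1 + k`, `2 + k` become `2 + i`, `1 + i`,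
  -- `i`, so the outer factors trade places.
  ...   | i , 2+k+i≡n
    rewrite s-✶ (2 + k) i 2+k+i≡n
          | s-✶ (1 + k) (1 + i) (trans (cong suc (+-suc k i)) 2+k+i≡n)
          | s-✶ k (2 + i) (trans (+-suc k (suc i)) (trans (cong suc (+-suc k i)) 2+k+i≡n)) =
    ≤-trans (≤-reflexive (*-comm (horner (s G) n (2 + i)) _))
            (horner-logConcave (s G) lc van n i)

-- Stable sets of paths

-- The binomial coefficient C(n + 1 - j, j), given by the recurrence on which the induction runs.
pathCount : ℕ → ℕ → ℕ
pathCount zero          zero          = 1
pathCount zero          (suc j)       = 0
pathCount (suc zero)    zero          = 1
pathCount (suc zero)    (suc zero)    = 1
pathCount (suc zero)    (suc (suc j)) = 0
pathCount (suc (suc n)) zero          = pathCount (suc n) zero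
pathCount (suc (suc n)) (suc j)       = pathCount (suc n) (suc j) + pathCount n j

-- The inequalities f(k+1)/f(k) ≤ g(k+1)/g(k) and g(k+2)/g(k+1) ≤ f(k+1)/f(k).
record Interlaced (f g : ℕ → ℕ) : Set where
  field
    logConcaveˡ : LogConcaveSeq f
    logConcaveʳ : LogConcaveSeq g
    slower      : ∀ k → g k * f (1 + k) ≤ f k * g (1 + k)
    faster      : ∀ k → f k * g (2 + k) ≤ f (1 + k) * g (1 + k)

pathCount-0 : ∀ n → pathCount n 0 ≡ 1
pathCount-0 zero          = refl
pathCount-0 (suc zero)    = refl
pathCount-0 (suc (suc n)) = pathCount-0 (suc n)

pathCount-vanishes : ∀ n → VanishesOnward (pathCount n)
pathCount-vanishes n             zero          e with () ← trans (sym (pathCount-0 n)) e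
pathCount-vanishes zero          (suc j)       _ = refl
pathCount-vanishes (suc zero)    (suc (suc j)) _ = refl
pathCount-vanishes (suc (suc n)) (suc j)       e = cong₂ _+_
  (pathCount-vanishes (suc n) (suc j) (m+n≡0⇒m≡0 (pathCount (suc n) (suc j)) e))
  (pathCount-vanishes n j (m+n≡0⇒n≡0 (pathCount (suc n) (suc j)) e))

-- With `h = g + x f`, products of coefficients are expanded and compared term by term. The new
-- `slower` rests on the old `faster`, the new `faster` on the old `slower` and log-concavity of
-- `g`, and log-concavity of `h` on all four fields.
pathCount-interlaced : ∀ n → Interlaced (pathCount n) (pathCount (suc n))
pathCount-interlaced zero    = record
  { logConcaveˡ = λ { zero → z≤n ; (suc k) → z≤n }
  ; logConcaveʳ = λ { zero → z≤n ; (suc zero) → z≤n ; (suc (suc k)) → z≤n }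
  ; slower      = λ { zero → z≤n ; (suc zero) → z≤n ; (suc (suc k)) → z≤n }
  ; faster      = λ { zero → z≤n ; (suc k) → z≤n }
  }
pathCount-interlaced (suc n) = record
  { logConcaveˡ = logConcaveʳ
  ; logConcaveʳ = lc
  ; slower      = sl
  ; faster      = λ k → ≤-trans
      (*-+-≤ (g k) {g (2 + k)} {f (1 + k)} (logConcaveʳ k)
        (≤-trans (slower k) (≤-reflexive (*-comm (f k) (g (1 + k))))))
      (≤-reflexive (sym (*-distribˡ-+ (g (1 + k)) (g (1 + k)) (f k))))
  }
  where
  f = pathCount n
  g = pathCount (suc n)
  h = pathCount (suc (suc n))
  open Interlaced (pathCount-interlaced n)

  sl : ∀ k → h k * g (1 + k) ≤ g k * h (1 + k)
  sl zero    = *-monoʳ-≤ (g 0) (m≤m+n (g 1) (f 0))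
  sl (suc k) = ≤-trans
    (+-*-≤ (g (2 + k)) {g (1 + k)} {f k} ≤-refl
      (≤-trans (faster k) (≤-reflexive (*-comm (f (1 + k)) (g (1 + k))))))
    (≤-reflexive (sym (*-distribˡ-+ (g (1 + k)) (g (2 + k)) (f (1 + k)))))

  lc : LogConcaveSeq h
  lc zero    = begin
    g 0 * (g 2 + f 1)
      ≤⟨ *-+-≤ (g 0) {g 2} {f 1} (logConcaveʳ 0) (slower 0) ⟩
    g 1 * g 1 + f 0 * g 1
      -- As `h 0` has no part from `f`, only two products arise on the left; the other terms of the
      -- square are slack.
      ≤⟨ m≤m+n _ _ ⟩
    (g 1 * g 1 + f 0 * g 1) + (f 0 * g 1 + f 0 * f 0)
      ≡⟨ square-+ (g 1) (f 0) ⟩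
    (g 1 + f 0) * (g 1 + f 0) ∎
    where open ≤-Reasoning
  lc (suc k) = begin
    (g₁ + f₀) * (g₃ + f₂)
      ≤⟨ +-*-≤ (g₃ + f₂) {g₁} {f₀}
           (*-+-≤ g₁ {g₃} {f₂} (logConcaveʳ (1 + k)) (slower (1 + k)))
           (*-+-≤ f₀ {g₃} {f₂} bound (logConcaveˡ k)) ⟩
    (g₂ * g₂ + f₁ * g₂) + (f₁ * g₂ + f₁ * f₁)
      ≡⟨ square-+ g₂ f₁ ⟩
    (g₂ + f₁) * (g₂ + f₁) ∎
    where
    open ≤-Reasoning
    f₀ = f k
    f₁ = f (1 + k)
    f₂ = f (2 + k)
    g₁ = g (1 + k)
    g₂ = g (2 + k)
    g₃ = g (3 + k)
    -- The one cross term that no field bounds directly; it comes from the chain f₀/f₁ ≤ g₁/g₂ ≤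
    -- g₂/g₃.
    bound : f₀ * g₃ ≤ f₁ * g₂
    bound = ≤-trans
      (ratio-trans f₀ f₁ g₁ g₂ g₂ g₃
        (≤-trans (faster k) (≤-reflexive (*-comm f₁ g₁)))
        (logConcaveʳ (1 + k)) (pathCount-vanishes (suc n) (2 + k)))
      (≤-reflexive (*-comm g₂ f₁))

-- The recurrence for paths, by the state of the first two vertices.

stable-outside : ∀ {n} (S : Subset n) → Stable (P (suc n)) (outside ∷ S) ⇔ Stable (P n) S
stable-outside S = mk⇔
  (λ st u v u∈ v∈ uv → st (suc u) (suc v) (there u∈) (there v∈) (Sum.map (cong suc) (cong suc) uv))
  (λ { st (suc u) (suc v) (there u∈) (there v∈) uv →
       st u v u∈ v∈ (Sum.map suc-injective suc-injective uv) })

-- The first vertex has the second as its only neighbour; with that one left out, it imposes nothing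
-- on the rest.
stable-inside-outside : ∀ {n} (S : Subset n) →
  Stable (P (2 + n)) (inside ∷ outside ∷ S) ⇔ Stable (P n) S
stable-inside-outside S = mk⇔
  (λ st u v u∈ v∈ uv → st (suc (suc u)) (suc (suc v)) (there (there u∈)) (there (there v∈))
    (Sum.map (cong (2 +_)) (cong (2 +_)) uv))
  λ { st zero          zero          _                  _                  (inj₁ ())
    ; st zero          zero          _                  _                  (inj₂ ())
    ; st zero          (suc zero)    _                  (there ())         _
    ; st (suc zero)    _             (there ())         _                  _
    ; st zero          (suc (suc v)) _                  _                  (inj₁ ())
    ; st zero          (suc (suc v)) _                  _                  (inj₂ ())
    ; st (suc (suc u)) zero          _                  _                  (inj₁ ())
    ; st (suc (suc u)) zero          _                  _                  (inj₂ ())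
    ; st (suc (suc u)) (suc (suc v)) (there (there u∈)) (there (there v∈)) uv →
        st u v u∈ v∈ (Sum.map (+-cancelˡ-≡ 2 _ _) (+-cancelˡ-≡ 2 _ _) uv)
    }

¬stable-inside-inside : ∀ {n} (S : Subset n) → ¬ Stable (P (2 + n)) (inside ∷ inside ∷ S)
¬stable-inside-inside S st = st zero (suc zero) here (there here) (inj₁ refl)

∑-path : ∀ n j →
  ∑ (λ S → ⟦ does (stable? (P n) S) ∧ does (∣ S ∣ ≟ j) ⟧) ≡ pathCount n j
∑-path zero          zero          = refl
∑-path zero          (suc j)       = refl
∑-path (suc zero)    zero          = refl
∑-path (suc zero)    (suc zero)    = refl
∑-path (suc zero)    (suc (suc j)) = refl
∑-path (suc (suc n)) j             = trans
  (cong₂ _+_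
    (trans (∑-cong λ S → cong (λ b → ⟦ b ∧ does (∣ S ∣ ≟ j) ⟧)
             (does-⇔ (stable-outside S) (stable? (P (2 + n)) (outside ∷ S)) (stable? (P (suc n)) S)))
           (∑-path (suc n) j))
    (cong₂ _+_
      (∑-cong λ S → cong (λ b → ⟦ b ∧ does (suc ∣ S ∣ ≟ j) ⟧)
        (does-⇔ (stable-inside-outside S) (stable? (P (2 + n)) (inside ∷ outside ∷ S)) (stable? (P n) S)))
      (∑-zero λ S → cong (λ b → ⟦ b ∧ does (2 + ∣ S ∣ ≟ j) ⟧)
        (dec-false (stable? (P (2 + n)) (inside ∷ inside ∷ S)) (¬stable-inside-inside S)))))
  (first j)
  where
  first : ∀ j →
    pathCount (suc n) j + (∑ (λ S → ⟦ does (stable? (P n) S) ∧ does (suc ∣ S ∣ ≟ j) ⟧) + 0) ≡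
    pathCount (2 + n) j
  -- A set containing the first vertex has positive size, so the second sum is zero for `j = 0`.
  first zero    = trans
    (cong (λ x → pathCount (suc n) 0 + (x + 0))
      (∑-zero λ S → cong ⟦_⟧ (∧-zeroʳ (does (stable? (P n) S)))))
    (+-identityʳ _)
  first (suc j) = cong (pathCount (suc n) (suc j) +_) (trans (+-identityʳ _) (∑-path n j))

s-P : ∀ n j → s (P n) j ≡ pathCount n j
s-P n j = trans (s-∑ (P n) j) (∑-path n j)

P-logConcave : ∀ n → LogConcaveSeq (s (P n))
P-logConcave n k rewrite s-P n k | s-P n (1 + k) | s-P n (2 + k) =
  Interlaced.logConcaveˡ (pathCount-interlaced n) k

P-vanishes : ∀ n → VanishesOnward (s (P n))
P-vanishes n k rewrite s-P n k | s-P n (1 + k) = pathCount-vanishes n k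

theorem7 : (n : ℕ) → n ≥ 1 → LogConcave (I (W n))
-- After rewriting, the three entries are the values of `s (W n)` at `k`, `1 + k` and `2 + k`.
theorem7 n _ h i j i≡1+h j≡1+i rewrite j≡1+i | i≡1+h = begin
  s (W n) k * s (W n) (2 + k)        ≤⟨ ✶-logConcave (P n) (P-logConcave n) (P-vanishes n) k ⟩
  s (W n) (1 + k) * s (W n) (1 + k)  ≡⟨ cong (s (W n) (1 + k) *_) (*-identityʳ _) ⟨
  s (W n) (1 + k) ^ 2                ∎
  where
  open ≤-Reasoning
  k = toℕ h
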